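{- Let $q_0,q_1,q_2,\ldots$ be the positions of the queens placed greedily along the square spiral on $\mathbb Z\times\mathbb Z$, and let $X_n,Y_n,M_n,P_n$ $(n\ge 0)$ be the recursively defined sequences given in the context. Then $q_0=(X_0,Y_0)=(0,0)$, and for all $k=0,1,2,\ldots$ $$q_{4k+1}=(X_{k+1},Y_{k+1}),\quad q_{4k+2}=(-Y_{k+1},X_{k+1}),\quad q_{4k+3}=(-X_{k+1},-Y_{k+1}),\quad q_{4k+4}=(Y_{k+1},-X_{k+1}).$$
   Context: Square spiral: the cells of the board are the points $(x,y)\in\mathbb Z\times\mathbb Z$, where the $x$-axis points South and the $y$-axis points East. The cells are numbered $0,1,2,\ldots$ along a square spiral starting at $(0,0)$ and moving successively East, North, West, South, East, North, .... Explicitly, cell $0$ is $(0,0)$, and for $k\ge1$ shell $k$ (the $8k$ cells with $\max(|x|,|y|)=k$) contains the cells numbered $(2k-1)^2,\ldots,4k(k+1)$, traversed in this order: $(k-1,k),(k-2,k),\ldots,(-k,k)$ (edge 1), then $(-k,k-1),\ldots,(-k,-k)$ (edge 2), then $(-k+1,-k),\ldots,(k,-k)$ (edge 3), then $(k,-k+1),\ldots,(k,k)$ (edge 4). Shells are traversed in the order $0,1,2,\ldots$. Greedy placement: the cells are considered in the order of their numbers, and a queen is placed in a cell if and only if it would not attack any queen placed earlier. Two queens attack each other if they share a row, a column, or a diagonal of slope $\pm1$ (blocking by other queens is irrelevant). $q_n$ ($n\ge0$) denotes the $(x,y)$ coordinates of the $n$th queen placed, starting with $q_0$ in cell $0$.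 Sequences: $\operatorname{mex}(S)$ is the smallest nonnegative integer not in $S$. Set $X_0=Y_0=M_0=P_0=0$ and, for $n>0$, $X_n=\operatorname{mex}\{X_i,Y_i:i<n\}$, $M_n=\operatorname{mex}\{M_i,P_i:i<n\}$, $Y_n=X_n+M_n$, $P_n=X_n+Y_n$. -}

module Defs where

open import Data.Bool using (true; false; if_then_else_)
open import Data.Fin using (Fin; toℕ; fromℕ<; inject)
open import Data.Fin.Properties
  using (¬∀⟶∃¬-smallest; pigeonhole; toℕ-fromℕ<; toℕ-inject)
open import Data.Integer as ℤ using (ℤ; +_; -_)
open import Data.List using (List; []; _∷_; length; lookup)
open import Data.List.Membership.DecPropositional using (_∈?_)
open import Data.List.Membership.Propositional using (_∈_; _∉_)
open import Data.List.Relation.Unary.All as All using (All)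
open import Data.List.Relation.Unary.Any using (index)
open import Data.List.Relation.Unary.Any.Properties using (lookup-index)
open import Data.Nat
  using (ℕ; zero; suc; _+_; _*_; _∸_; _^_; _≤_; _<_; _<?_; _≤′_; ≤′-refl; ≤′-step)
open import Data.Nat.Properties as ℕₚ using ()
open import Data.Nat.Tactic.RingSolver using (solve-∀)
open import Data.Product using (_×_; _,_; proj₁; proj₂; ∃; ∃-syntax)
open import Data.Sum using (_⊎_)
open import Relation.Binary using (tri<; tri≈; tri>)
open import Relation.Binary.PropositionalEquality
  using (_≡_; refl; sym; trans; cong; subst)
open import Relation.Nullary using (¬_; Dec; does; ¬?; contradiction)
open import Relation.Nullary.Decidable using (_⊎-dec_; dec-true; dec-false)

-- The x-axis points South and the y-axis points East.
Point : Set
Point = ℤ × ℤ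

edge₁ edge₂ edge₃ edge₄ : ℕ → ℕ → Point
edge₁ k i = + k ℤ.- + 1 ℤ.- + i , + k
edge₂ k i = - (+ k) , + k ℤ.- + 1 ℤ.- + i
edge₃ k i = - (+ k) ℤ.+ + 1 ℤ.+ + i , - (+ k)
edge₄ k i = + k , - (+ k) ℤ.+ + 1 ℤ.+ + i

shellSize : ℕ → ℕ
shellSize zero    = 1
shellSize (suc k) = 8 * suc k

-- inShell k j is the j-th cell of shell k; only j < shellSize k is meaningful.
inShell : ℕ → ℕ → Point
inShell zero      j = + 0 , + 0
inShell k@(suc _) j =
  if does (j <? 2 * k) then edge₁ k j else
  if does (j <? 4 * k) then edge₂ k (j ∸ 2 * k) else
  if does (j <? 6 * k) then edge₃ k (j ∸ 4 * k) else
  edge₄ k (j ∸ 6 * k)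

advance : ℕ × ℕ → ℕ × ℕ
advance (k , j) = if does (suc j <? shellSize k) then (k , suc j) else (suc k , 0)

-- The shell containing cell number c, and the offset of the cell in that shell.
locate : ℕ → ℕ × ℕ
locate zero    = 0 , 0
locate (suc c) = advance (locate c)

cell : ℕ → Point
cell c = let (k , j) = locate c in inShell k j

advance-within : ∀ k j → suc j < shellSize k → advance (k , j) ≡ (k , suc j)
advance-within k j lt rewrite dec-true (suc j <? shellSize k) lt = refl

advance-last : ∀ k j → shellSize k ≡ suc j → advance (k , j) ≡ (suc k , 0)
advance-last k j eq
  rewrite dec-false (suc j <? shellSize k) (λ lt → ℕₚ.<⇒≢ lt (sym eq)) = refl

locate-within : ∀ c {k} → locate c ≡ (k , 0) →
                ∀ j → j < shellSize k → locate (c + j) ≡ (k , j)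
locate-within c start zero lt = trans (cong locate (ℕₚ.+-identityʳ c)) start
locate-within c {k} start (suc j) lt =
  trans (cong locate (ℕₚ.+-suc c j))
    (trans (cong advance (locate-within c start j (ℕₚ.<-trans (ℕₚ.n<1+n j) lt)))
           (advance-within k j lt))

locate-shell : ∀ k → locate ((2 * k + 1) ^ 2) ≡ (suc k , 0)
locate-shell zero = refl
locate-shell (suc k) =
  trans (cong locate (numbering k))
    (trans (cong advance (locate-within ((2 * k + 1) ^ 2) (locate-shell k) (7 + 8 * k) last<size))
           (advance-last (suc k) (7 + 8 * k) (size k)))
  where
  -- The squares are unfolded for the benefit of the ring solver.
  numbering : ∀ k → (2 * (1 + k) + 1) * ((2 * (1 + k) + 1) * 1)
                  ≡ 1 + ((2 * k + 1) * ((2 * k + 1) * 1) + (7 + 8 * k))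
  numbering = solve-∀
  size : ∀ k → 8 * suc k ≡ suc (7 + 8 * k)
  size k = ℕₚ.*-suc 8 k
  last<size : 7 + 8 * k < 8 * suc k
  last<size = ℕₚ.≤-reflexive (sym (size k))

-- Shell K = k + 1 is numbered from (2K - 1)² = (2k + 1)² onwards.
cell-numbering : ∀ k j → j < 8 * suc k → cell ((2 * k + 1) ^ 2 + j) ≡ inShell (suc k) j
cell-numbering k j lt =
  cong (λ (k , j) → inShell k j) (locate-within ((2 * k + 1) ^ 2) (locate-shell k) j lt)

Attacks : Point → Point → Set
Attacks (x , y) (x′ , y′) =
  x ≡ x′ ⊎ y ≡ y′ ⊎ x ℤ.+ y ≡ x′ ℤ.+ y′ ⊎ x ℤ.- y ≡ x′ ℤ.- y′

attacks? : ∀ p q → Dec (Attacks p q)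
attacks? (x , y) (x′ , y′) =
  (x ℤ.≟ x′) ⊎-dec (y ℤ.≟ y′) ⊎-dec
  (x ℤ.+ y ℤ.≟ x′ ℤ.+ y′) ⊎-dec (x ℤ.- y ℤ.≟ x′ ℤ.- y′)

Unattacking : List Point → Point → Set
Unattacking qs p = All (λ q → ¬ Attacks p q) qs

unattacking? : ∀ qs p → Dec (Unattacking qs p)
unattacking? qs p = All.all? (λ q → ¬? (attacks? p q)) qs

-- The queens placed in cells numbered below c, latest first.
queensBefore : ℕ → List Point
queensBefore zero    = []
queensBefore (suc c) =
  if does (unattacking? (queensBefore c) (cell c))
  then cell c ∷ queensBefore c
  else queensBefore c

HasQueen : ℕ → Set
HasQueen c = Unattacking (queensBefore c) (cell c)

-- "q n is defined and equals p", counting from n = 0.  This is a relation because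
-- totality of q (there being infinitely many queens) is not known in advance.
IsNthQueen : ℕ → Point → Set
IsNthQueen n p = ∃[ c ] (HasQueen c × length (queensBefore c) ≡ n × cell c ≡ p)

queensBefore-placed : ∀ c → HasQueen c → queensBefore (suc c) ≡ cell c ∷ queensBefore c
queensBefore-placed c h
  rewrite dec-true (unattacking? (queensBefore c) (cell c)) h = refl

queensBefore-step : ∀ c → length (queensBefore c) ≤ length (queensBefore (suc c))
queensBefore-step c with does (unattacking? (queensBefore c) (cell c))
... | true  = ℕₚ.n≤1+n _
... | false = ℕₚ.≤-refl

queensBefore-mono : ∀ {c d} → c ≤′ d → length (queensBefore c) ≤ length (queensBefore d)
queensBefore-mono ≤′-refl      = ℕₚ.≤-refl
queensBefore-mono (≤′-step {n = d} le) = ℕₚ.≤-trans (queensBefore-mono le) (queensBefore-step d)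

queensBefore-strict : ∀ {c d} → HasQueen c → c < d →
                      length (queensBefore c) < length (queensBefore d)
queensBefore-strict {c} {d} h lt =
  subst (_≤ length (queensBefore d)) (cong length (queensBefore-placed c h))
        (queensBefore-mono (ℕₚ.≤⇒≤′ lt))

IsNthQueen-unique : ∀ {n p p′} → IsNthQueen n p → IsNthQueen n p′ → p ≡ p′
IsNthQueen-unique (c , h , e , refl) (c′ , h′ , e′ , refl) with ℕₚ.<-cmp c c′
... | tri≈ _ refl _ = refl
... | tri< lt _ _ = contradiction (trans e (sym e′)) (ℕₚ.<⇒≢ (queensBefore-strict h lt))
... | tri> _ _ gt = contradiction (trans e′ (sym e)) (ℕₚ.<⇒≢ (queensBefore-strict h′ gt))

IsMex : List ℕ → ℕ → Set
IsMex S m = m ∉ S × (∀ {j} → j < m → j ∈ S)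

mex-exists : ∀ S → ∃ (IsMex S)
mex-exists S =
  let (i , i∉S , below) = ¬∀⟶∃¬-smallest (suc (length S)) (λ i → toℕ i ∈ S)
                            (λ i → _∈?_ ℕₚ._≟_ (toℕ i) S) overfull
  in toℕ i , i∉S , λ {j} j<i →
       subst (_∈ S) (trans (toℕ-inject (fromℕ< j<i)) (toℕ-fromℕ< j<i)) (below (fromℕ< j<i))
  where
  overfull : ¬ (∀ (i : Fin (suc (length S))) → toℕ i ∈ S)
  overfull all =
    let (i , j , i<j , eq) = pigeonhole (ℕₚ.n<1+n (length S)) (λ i → index (all i))
    in ℕₚ.<⇒≢ i<j
         (trans (lookup-index (all i))
           (trans (cong (lookup S) eq) (sym (lookup-index (all j)))))

mex : List ℕ → ℕ
mex S = proj₁ (mex-exists S)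

-- XYs n and MPs n list the elements of {Xᵢ, Yᵢ : i < n} and {Mᵢ, Pᵢ : i < n}.
X Y M P : ℕ → ℕ
XYs MPs : ℕ → List ℕ

X zero    = 0
X (suc n) = mex (XYs (suc n))

M zero    = 0
M (suc n) = mex (MPs (suc n))

Y zero    = 0
Y (suc n) = X (suc n) + M (suc n)

P zero    = 0
P (suc n) = X (suc n) + Y (suc n)

XYs zero    = []
XYs (suc n) = X n ∷ Y n ∷ XYs n

MPs zero    = []
MPs (suc n) = M n ∷ P n ∷ MPs n

{-# OPTIONS --safe #-}
module Submission where

-- Let A = {Xᵢ, Yᵢ : i ≤ n} and D = {Mᵢ, Pᵢ : i ≤ n}.  Since X + M = Y and X + Y = P,
-- the lines through (Xᵢ, Yᵢ) and its quarter turns about the origin are exactly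
-- x = ±a and y = ±a with a ∈ {Xᵢ, Yᵢ}, and x + y = ±d and x - y = ±d with d ∈ {Mᵢ, Pᵢ}.
-- Hence those queens attack (x, y) iff |x| ∈ A, |y| ∈ A, |x + y| ∈ D or |x - y| ∈ D
-- (attacked⇒Covered, Covered⇒attacked), a condition invariant under quarter turns.
--
-- The spiral is also compatible with quarter turns: each later edge of a shell is
-- the previous one turned (inShell-rotate).  So it suffices to look at the cells
-- (K - 1 - j, K), j < 2K, of the first edge of shell K.  If such a cell is not attacked,
-- then |x| ≥ mex A and both |x + y| and |x - y| are at least mex D, and the smaller of
-- the latter two is K - |x|; therefore K ≥ mex A + mex D = Yₙ₊₁ (not-Covered⇒Y≤).
-- Thus no further queen is placed in shells K < Yₙ₊₁ (empty-shell).
--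
-- In shell K = Yₙ₊₁, the cell with j = Mₙ₊₁ - 1 is (Xₙ₊₁, Yₙ₊₁).  The cells before it on
-- the first edge have |x - y| = j + 1 < mex D, so they are attacked; the cell itself is
-- free, because Xₙ₊₁ and Mₙ₊₁ are mexes and Yₙ₊₁ and Pₙ₊₁ exceed everything in A and D
-- (queen-not-Covered); the cells after it share its column.  The same holds on the other
-- edges, because the new queen and its turns do not attack each other: a point that
-- attacks one of its own turns lies on a row, column or diagonal through the origin, and
-- is then attacked by the queen there (rotate-attacks-self).  So shell Yₙ₊₁ gets exactly
-- the four turns of (Xₙ₊₁, Yₙ₊₁), one on each edge, and induction on n finishes the proof.

open import Defs
open import Data.Integer as ℤ using (ℤ; +_; -_; -[1+_]; ∣_∣)
import Data.Integer.Properties as ℤₚ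
open import Algebra.Properties.AbelianGroup ℤₚ.+-0-abelianGroup using (∙-cancelˡ)
import Data.Integer.Tactic.RingSolver as ℤSolver
open import Data.List using (List; []; _∷_; length)
open import Data.List.Membership.Propositional using (_∈_; _∉_)
open import Data.List.Relation.Binary.Subset.Propositional using (_⊆_)
open import Data.List.Relation.Unary.All as All using (All; []; _∷_)
open import Data.List.Relation.Unary.All.Properties using (¬Any⇒All¬; All¬⇒¬Any)
open import Data.List.Relation.Unary.Any using (Any; here; there)
open import Data.Nat
  using (ℕ; zero; suc; _+_; _*_; _∸_; _^_; _≤_; _<_; _<?_; _≤?_; _≤′_; ≤′-refl; ≤′-step; z≤n; s≤s)
open import Data.Nat.Properties
open import Data.Nat.Tactic.RingSolver using (solve-∀)
open import Data.Product using (_×_; _,_; proj₁; proj₂; ∃-syntax)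
open import Data.Sum using (_⊎_; inj₁; inj₂; [_,_]′)
import Data.Sum as Sum
open import Relation.Binary.PropositionalEquality
  using (_≡_; refl; sym; trans; cong; cong₂; subst)
open import Relation.Nullary using (¬_; yes; no)
open import Relation.Nullary.Decidable using (dec-true; dec-false)
open import Function using (_∘_)

-- Mexes and the growth of the four sequences

mex-∉ : ∀ S → mex S ∉ S
mex-∉ S = proj₁ (proj₂ (mex-exists S))

<mex⇒∈ : ∀ S {j} → j < mex S → j ∈ S
<mex⇒∈ S = proj₂ (proj₂ (mex-exists S))

∉⇒mex≤ : ∀ S {j} → j ∉ S → mex S ≤ j
∉⇒mex≤ S j∉S = ≮⇒≥ (j∉S ∘ <mex⇒∈ S)

mex-strict : ∀ {S T} → S ⊆ T → mex S ∈ T → mex S < mex T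
mex-strict {S} {T} S⊆T m∈T =
  ≤∧≢⇒< (∉⇒mex≤ S (mex-∉ T ∘ S⊆T)) (λ eq → mex-∉ T (subst (_∈ T) eq m∈T))

-- The initial values fit the recursion: X 0 and M 0 are the mex of the empty set.
X≡mex : ∀ n → X n ≡ mex (XYs n)
X≡mex zero    = refl
X≡mex (suc n) = refl

M≡mex : ∀ n → M n ≡ mex (MPs n)
M≡mex zero    = refl
M≡mex (suc n) = refl

Y≡X+M : ∀ n → Y n ≡ X n + M n
Y≡X+M zero    = refl
Y≡X+M (suc n) = refl

P≡X+Y : ∀ n → P n ≡ X n + Y n
P≡X+Y zero    = refl
P≡X+Y (suc n) = refl

X≤ : ∀ n {j} → j ∉ XYs n → X n ≤ j
X≤ n j∉ = subst (_≤ _) (sym (X≡mex n)) (∉⇒mex≤ (XYs n) j∉)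

M≤ : ∀ n {j} → j ∉ MPs n → M n ≤ j
M≤ n j∉ = subst (_≤ _) (sym (M≡mex n)) (∉⇒mex≤ (MPs n) j∉)

X-increasing : ∀ n → X n < X (suc n)
X-increasing n = subst (_< X (suc n)) (sym (X≡mex n))
  (mex-strict (there ∘ there) (here (sym (X≡mex n))))

M-increasing : ∀ n → M n < M (suc n)
M-increasing n = subst (_< M (suc n)) (sym (M≡mex n))
  (mex-strict (there ∘ there) (here (sym (M≡mex n))))

Y-increasing : ∀ n → Y n < Y (suc n)
Y-increasing n = subst (_< Y (suc n)) (sym (Y≡X+M n))
  (+-mono-< (X-increasing n) (M-increasing n))

P-increasing : ∀ n → P n < P (suc n)
P-increasing n = subst (_< P (suc n)) (sym (P≡X+Y n))
  (+-mono-< (X-increasing n) (Y-increasing n))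

XYs<Y : ∀ n → All (_< Y n) (XYs n)
XYs<Y zero    = []
XYs<Y (suc n) = ≤-<-trans X≤Y (Y-increasing n) ∷ Y-increasing n
              ∷ All.map (λ lt → <-trans lt (Y-increasing n)) (XYs<Y n)
  where
  X≤Y : X n ≤ Y n
  X≤Y = subst (X n ≤_) (sym (Y≡X+M n)) (m≤m+n (X n) (M n))

MPs<P : ∀ n → All (_< P n) (MPs n)
MPs<P zero    = []
MPs<P (suc n) = ≤-<-trans M≤P (P-increasing n) ∷ P-increasing n
              ∷ All.map (λ lt → <-trans lt (P-increasing n)) (MPs<P n)
  where
  M≤P : M n ≤ P n
  M≤P = subst (M n ≤_) (sym (trans (P≡X+Y n) (cong (λ m → X n + m) (Y≡X+M n))))
          (m≤n⇒m≤o+n (X n) (m≤n+m (M n) (X n)))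

Y∉XYs : ∀ n → Y n ∉ XYs n
Y∉XYs n Y∈ = <-irrefl refl (All.lookup (XYs<Y n) Y∈)

P∉MPs : ∀ n → P n ∉ MPs n
P∉MPs n P∈ = <-irrefl refl (All.lookup (MPs<P n) P∈)

-- Quarter turns and the lines through a point

-- The quarter turn about the origin that takes South to East.
turn : Point → Point
turn (x , y) = - y , x

-- r successive quarter turns.
rotate : ℕ → Point → Point
rotate zero    p = p
rotate (suc r) p = turn (rotate r p)

Attacks-turn : ∀ {p q} → Attacks p q → Attacks (turn p) (turn q)
Attacks-turn (inj₁ e)        = inj₂ (inj₁ e)
Attacks-turn (inj₂ (inj₁ e)) = inj₁ (cong -_ e)
Attacks-turn {x , y} {x′ , y′} (inj₂ (inj₂ (inj₁ e))) =
  inj₂ (inj₂ (inj₂ (trans (lemma x y) (trans (cong -_ e) (sym (lemma x′ y′))))))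
  where
  lemma : ∀ x y → - y ℤ.- x ≡ - (x ℤ.+ y)
  lemma = ℤSolver.solve-∀
Attacks-turn {x , y} {x′ , y′} (inj₂ (inj₂ (inj₂ e))) =
  inj₂ (inj₂ (inj₁ (trans (ℤₚ.+-comm (- y) x) (trans e (ℤₚ.+-comm x′ (- y′))))))

Attacks-rotate : ∀ r {p q} → Attacks p q → Attacks (rotate r p) (rotate r q)
Attacks-rotate zero    a = a
Attacks-rotate (suc r) a = Attacks-turn (Attacks-rotate r a)

-- (x , y) lies on one of the lines x = ±a, y = ±a (a ∈ A), x + y = ±d, x - y = ±d (d ∈ D).
Covered : List ℕ → List ℕ → Point → Set
Covered A D (x , y) = ∣ x ∣ ∈ A ⊎ ∣ y ∣ ∈ A ⊎ ∣ x ℤ.+ y ∣ ∈ D ⊎ ∣ x ℤ.- y ∣ ∈ D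

-- All four queen lines through (x , y) are among the lines x = ±a, y = ±a (a ∈ A),
-- x + y = ±d, x - y = ±d (d ∈ D).
OnLines : List ℕ → List ℕ → Point → Set
OnLines A D (x , y) = ∣ x ∣ ∈ A × ∣ y ∣ ∈ A × ∣ x ℤ.+ y ∣ ∈ D × ∣ x ℤ.- y ∣ ∈ D

∣turn-sum∣ : ∀ x y → ∣ - y ℤ.+ x ∣ ≡ ∣ x ℤ.- y ∣
∣turn-sum∣ x y = cong ∣_∣ (ℤₚ.+-comm (- y) x)

∣turn-diff∣ : ∀ x y → ∣ - y ℤ.- x ∣ ≡ ∣ x ℤ.+ y ∣
∣turn-diff∣ x y = trans (cong ∣_∣ (lemma x y)) (ℤₚ.∣-i∣≡∣i∣ (x ℤ.+ y))
  where
  lemma : ∀ x y → - y ℤ.- x ≡ - (x ℤ.+ y)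
  lemma = ℤSolver.solve-∀

module _ {A D : List ℕ} where

  Covered-turn : ∀ {p} → Covered A D p → Covered A D (turn p)
  Covered-turn (inj₁ m) = inj₂ (inj₁ m)
  Covered-turn {x , y} (inj₂ (inj₁ m)) = inj₁ (subst (_∈ A) (sym (ℤₚ.∣-i∣≡∣i∣ y)) m)
  Covered-turn {x , y} (inj₂ (inj₂ (inj₁ m))) =
    inj₂ (inj₂ (inj₂ (subst (_∈ D) (sym (∣turn-diff∣ x y)) m)))
  Covered-turn {x , y} (inj₂ (inj₂ (inj₂ m))) =
    inj₂ (inj₂ (inj₁ (subst (_∈ D) (sym (∣turn-sum∣ x y)) m)))

  Covered-turn⁻ : ∀ {p} → Covered A D (turn p) → Covered A D p
  Covered-turn⁻ {x , y} (inj₁ m) = inj₂ (inj₁ (subst (_∈ A) (ℤₚ.∣-i∣≡∣i∣ y) m))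
  Covered-turn⁻ (inj₂ (inj₁ m)) = inj₁ m
  Covered-turn⁻ {x , y} (inj₂ (inj₂ (inj₁ m))) =
    inj₂ (inj₂ (inj₂ (subst (_∈ D) (∣turn-sum∣ x y) m)))
  Covered-turn⁻ {x , y} (inj₂ (inj₂ (inj₂ m))) =
    inj₂ (inj₂ (inj₁ (subst (_∈ D) (∣turn-diff∣ x y) m)))

  Covered-rotate : ∀ r {p} → Covered A D p → Covered A D (rotate r p)
  Covered-rotate zero    c = c
  Covered-rotate (suc r) {p} c = Covered-turn {rotate r p} (Covered-rotate r c)

  Covered-rotate⁻ : ∀ r {p} → Covered A D (rotate r p) → Covered A D p
  Covered-rotate⁻ zero    c = c
  Covered-rotate⁻ (suc r) {p} c = Covered-rotate⁻ r (Covered-turn⁻ {rotate r p} c)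

  OnLines-turn : ∀ {p} → OnLines A D p → OnLines A D (turn p)
  OnLines-turn {x , y} (mx , my , ms , md) =
    subst (_∈ A) (sym (ℤₚ.∣-i∣≡∣i∣ y)) my , mx ,
    subst (_∈ D) (sym (∣turn-sum∣ x y)) md , subst (_∈ D) (sym (∣turn-diff∣ x y)) ms

  OnLines-rotate : ∀ r {p} → OnLines A D p → OnLines A D (rotate r p)
  OnLines-rotate zero    o = o
  OnLines-rotate (suc r) {p} o = OnLines-turn {rotate r p} (OnLines-rotate r o)

  Attacks⇒Covered : ∀ {p q} → OnLines A D q → Attacks p q → Covered A D p
  Attacks⇒Covered (mx , my , ms , md) =
    Sum.map (λ e → subst (_∈ A) (cong ∣_∣ (sym e)) mx)
      (Sum.map (λ e → subst (_∈ A) (cong ∣_∣ (sym e)) my)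
        (Sum.map (λ e → subst (_∈ D) (cong ∣_∣ (sym e)) ms)
                 (λ e → subst (_∈ D) (cong ∣_∣ (sym e)) md)))

∣i∣≡∣j∣⇒i≡±j : ∀ {i j} → ∣ i ∣ ≡ ∣ j ∣ → i ≡ j ⊎ i ≡ - j
∣i∣≡∣j∣⇒i≡±j {+ _}       {+ _}       refl = inj₁ refl
∣i∣≡∣j∣⇒i≡±j {+ _}       { -[1+ _ ]} refl = inj₂ refl
∣i∣≡∣j∣⇒i≡±j { -[1+ _ ]} {+ _}       refl = inj₂ refl
∣i∣≡∣j∣⇒i≡±j { -[1+ _ ]} { -[1+ _ ]} refl = inj₁ refl

-- Some queen line through (x , y) is, up to sign, the parallel line through (u , v).
SameDistances : Point → Point → Set
SameDistances (x , y) (u , v) =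
  ∣ x ∣ ≡ ∣ u ∣ ⊎ ∣ y ∣ ≡ ∣ v ∣ ⊎ ∣ x ℤ.+ y ∣ ≡ ∣ u ℤ.+ v ∣ ⊎ ∣ x ℤ.- y ∣ ≡ ∣ u ℤ.- v ∣

-- A half turn negates a point, so a point and its half turn have between them both
-- lines at each of these distances.
SameDistances⇒Attacks : ∀ {p q} → SameDistances p q →
                        Attacks p q ⊎ Attacks p (turn (turn q))
SameDistances⇒Attacks (inj₁ e) = Sum.map inj₁ inj₁ (∣i∣≡∣j∣⇒i≡±j e)
SameDistances⇒Attacks (inj₂ (inj₁ e)) =
  Sum.map (inj₂ ∘ inj₁) (inj₂ ∘ inj₁) (∣i∣≡∣j∣⇒i≡±j e)
SameDistances⇒Attacks {q = u , v} (inj₂ (inj₂ (inj₁ e))) =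
  Sum.map (inj₂ ∘ inj₂ ∘ inj₁)
          (λ e′ → inj₂ (inj₂ (inj₁ (trans e′ (ℤₚ.neg-distrib-+ u v)))))
          (∣i∣≡∣j∣⇒i≡±j e)
SameDistances⇒Attacks {q = u , v} (inj₂ (inj₂ (inj₂ e))) =
  Sum.map (inj₂ ∘ inj₂ ∘ inj₂)
          (λ e′ → inj₂ (inj₂ (inj₂ (trans e′ (ℤₚ.neg-distrib-+ u (- v))))))
          (∣i∣≡∣j∣⇒i≡±j e)

-- A covering line at one of the distances |u|, |v|, |u - v|, |u + v| is accounted for by
-- (u , v) or by its quarter turn; which of the two depends on the direction of the line.
Covered-∷ : ∀ {A D a b m s p} u v →
  a ≡ ∣ u ∣ → b ≡ ∣ v ∣ → m ≡ ∣ u ℤ.- v ∣ → s ≡ ∣ u ℤ.+ v ∣ →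
  Covered (a ∷ b ∷ A) (m ∷ s ∷ D) p →
  (SameDistances p (u , v) ⊎ SameDistances p (turn (u , v))) ⊎ Covered A D p
Covered-∷ {A} {D} {p = x , y} u v refl refl refl refl = go
  where
  go : Covered (_ ∷ _ ∷ A) (_ ∷ _ ∷ D) (x , y) → _
  go (inj₁ (here e))                  = inj₁ (inj₁ (inj₁ e))
  go (inj₁ (there (here e)))          = inj₁ (inj₂ (inj₁ (trans e (sym (ℤₚ.∣-i∣≡∣i∣ v)))))
  go (inj₁ (there (there i)))         = inj₂ (inj₁ i)
  go (inj₂ (inj₁ (here e)))           = inj₁ (inj₂ (inj₂ (inj₁ e)))
  go (inj₂ (inj₁ (there (here e))))   = inj₁ (inj₁ (inj₂ (inj₁ e)))
  go (inj₂ (inj₁ (there (there i))))  = inj₂ (inj₂ (inj₁ i))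
  go (inj₂ (inj₂ (inj₁ (here e))))    =
    inj₁ (inj₂ (inj₂ (inj₂ (inj₁ (trans e (sym (∣turn-sum∣ u v)))))))
  go (inj₂ (inj₂ (inj₁ (there (here e)))))  = inj₁ (inj₁ (inj₂ (inj₂ (inj₁ e))))
  go (inj₂ (inj₂ (inj₁ (there (there i))))) = inj₂ (inj₂ (inj₂ (inj₁ i)))
  go (inj₂ (inj₂ (inj₂ (here e))))          = inj₁ (inj₁ (inj₂ (inj₂ (inj₂ e))))
  go (inj₂ (inj₂ (inj₂ (there (here e)))))  =
    inj₁ (inj₂ (inj₂ (inj₂ (inj₂ (trans e (sym (∣turn-diff∣ u v)))))))
  go (inj₂ (inj₂ (inj₂ (there (there i))))) = inj₂ (inj₂ (inj₂ (inj₂ i)))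

-- The queens and the lines that they control

queen : ℕ → Point
queen n = + X n , + Y n

-- The list L preceded by the turns rotate 0 q to rotate (r - 1) q, the latest first.
rotations : ℕ → Point → List Point → List Point
rotations zero    q L = L
rotations (suc r) q L = rotate r q ∷ rotations r q L

-- The four turns of each queen i with 0 < i ≤ n, and the queen at the origin once, in
-- reverse order of placement.
queens : ℕ → List Point
queens zero    = queen 0 ∷ []
queens (suc n) = rotations 4 (queen (suc n)) (queens n)

∣X-Y∣≡M : ∀ n → ∣ + X n ℤ.- + Y n ∣ ≡ M n
∣X-Y∣≡M n = trans (cong (λ b → ∣ + X n ℤ.- + b ∣) (Y≡X+M n))
  (trans (cong ∣_∣ (trans (cong (λ i → + X n ℤ.- i) (ℤₚ.pos-+ (X n) (M n))) (lemma (+ X n) (+ M n))))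
         (ℤₚ.∣-i∣≡∣i∣ (+ M n)))
  where
  lemma : ∀ i j → i ℤ.- (i ℤ.+ j) ≡ - j
  lemma = ℤSolver.solve-∀

queen-OnLines : ∀ n → OnLines (XYs (suc n)) (MPs (suc n)) (queen n)
queen-OnLines n =
  here refl , there (here refl) , there (here (sym (P≡X+Y n))) , here (∣X-Y∣≡M n)

queens-OnLines : ∀ n → All (OnLines (XYs (suc n)) (MPs (suc n))) (queens n)
queens-OnLines zero    = queen-OnLines 0 ∷ []
queens-OnLines (suc n) = rotated 3 ∷ rotated 2 ∷ rotated 1 ∷ rotated 0
  ∷ All.map (λ (mx , my , ms , md) →
      there (there mx) , there (there my) , there (there ms) , there (there md))
      (queens-OnLines n)
  where
  rotated : ∀ r → OnLines (XYs (suc (suc n))) (MPs (suc (suc n))) (rotate r (queen (suc n)))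
  rotated r = OnLines-rotate r {queen (suc n)} (queen-OnLines (suc n))

attacked⇒Covered : ∀ n {p} → Any (Attacks p) (queens n) →
                   Covered (XYs (suc n)) (MPs (suc n)) p
attacked⇒Covered n = go (queens-OnLines n)
  where
  go : ∀ {A D L p} → All (OnLines A D) L → Any (Attacks p) L → Covered A D p
  go {p = p} (_∷_ {x = q} o os) (here a)  = Attacks⇒Covered {p = p} {q} o a
  go (o ∷ os) (there i) = go os i

Covered⇒attacked : ∀ n {p} → Covered (XYs (suc n)) (MPs (suc n)) p →
                   Any (Attacks p) (queens n)
Covered⇒attacked n {p} c
  with Covered-∷ {p = p} (+ X n) (+ Y n) refl refl (sym (∣X-Y∣≡M n)) (P≡X+Y n) c
Covered⇒attacked zero {p} c | inj₁ (inj₁ s) =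
  [ here , here ]′ (SameDistances⇒Attacks {p} {queen 0} s)
Covered⇒attacked zero {p} c | inj₁ (inj₂ s) =
  [ here , here ]′ (SameDistances⇒Attacks {p} {queen 0} s)
Covered⇒attacked zero c | inj₂ (inj₁ ())
Covered⇒attacked zero c | inj₂ (inj₂ (inj₁ ()))
Covered⇒attacked zero c | inj₂ (inj₂ (inj₂ (inj₁ ())))
Covered⇒attacked zero c | inj₂ (inj₂ (inj₂ (inj₂ ())))
Covered⇒attacked (suc n) {p} c | inj₁ (inj₁ s) =
  [ there ∘ there ∘ there ∘ here , there ∘ here ]′
    (SameDistances⇒Attacks {p} {queen (suc n)} s)
Covered⇒attacked (suc n) {p} c | inj₁ (inj₂ s) =
  [ there ∘ there ∘ here , here ]′
    (SameDistances⇒Attacks {p} {turn (queen (suc n))} s)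
Covered⇒attacked (suc n) c | inj₂ c′ = there (there (there (there (Covered⇒attacked n c′))))

-- As XYs n and MPs n only involve indices below n, this says that queen n is not
-- attacked by the earlier ones and their turns.
queen-not-Covered : ∀ n → ¬ Covered (XYs n) (MPs n) (queen n)
queen-not-Covered n (inj₁ i) = mex-∉ (XYs n) (subst (_∈ XYs n) (X≡mex n) i)
queen-not-Covered n (inj₂ (inj₁ i)) = Y∉XYs n i
queen-not-Covered n (inj₂ (inj₂ (inj₁ i))) =
  P∉MPs n (subst (_∈ MPs n) (sym (P≡X+Y n)) i)
queen-not-Covered n (inj₂ (inj₂ (inj₂ i))) =
  mex-∉ (MPs n) (subst (_∈ MPs n) (trans (∣X-Y∣≡M n) (M≡mex n)) i)

-- The turns of a queen do not attack each other

-i≡i⇒i≡0 : ∀ i → - i ≡ i → i ≡ + 0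
-i≡i⇒i≡0 (+ zero) e = refl

Attacks-sym : ∀ {p q} → Attacks p q → Attacks q p
Attacks-sym = Sum.map sym (Sum.map sym (Sum.map sym sym))

turn⁴ : ∀ p → rotate 4 p ≡ p
turn⁴ (x , y) = cong₂ _,_ (ℤₚ.neg-involutive x) (ℤₚ.neg-involutive y)

turn-attacks-self : ∀ {p} → Attacks (turn p) p → Attacks p (queen 0)
turn-attacks-self {x , y} (inj₁ e) =
  inj₂ (inj₂ (inj₁ (trans (cong (ℤ._+ y) (sym e)) (ℤₚ.+-inverseˡ y))))
turn-attacks-self {x , y} (inj₂ (inj₁ e)) = inj₂ (inj₂ (inj₂ (ℤₚ.i≡j⇒i-j≡0 e)))
turn-attacks-self {x , y} (inj₂ (inj₂ (inj₁ e))) =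
  inj₂ (inj₁ (-i≡i⇒i≡0 y (∙-cancelˡ x (- y) y (trans (ℤₚ.+-comm x (- y)) e))))
turn-attacks-self {x , y} (inj₂ (inj₂ (inj₂ e))) =
  inj₁ (-i≡i⇒i≡0 x (∙-cancelˡ (- y) (- x) x (trans e (ℤₚ.+-comm x (- y)))))

turn²-attacks-self : ∀ {p} → Attacks (turn (turn p)) p → Attacks p (queen 0)
turn²-attacks-self {x , y} (inj₁ e) = inj₁ (-i≡i⇒i≡0 x e)
turn²-attacks-self {x , y} (inj₂ (inj₁ e)) = inj₂ (inj₁ (-i≡i⇒i≡0 y e))
turn²-attacks-self {x , y} (inj₂ (inj₂ (inj₁ e))) =
  inj₂ (inj₂ (inj₁ (-i≡i⇒i≡0 (x ℤ.+ y) (trans (ℤₚ.neg-distrib-+ x y) e))))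
turn²-attacks-self {x , y} (inj₂ (inj₂ (inj₂ e))) =
  inj₂ (inj₂ (inj₂ (-i≡i⇒i≡0 (x ℤ.- y) (trans (ℤₚ.neg-distrib-+ x (- y)) e))))

-- A point attacking a proper turn of itself is attacked by the queen at the origin,
-- which is queen 0.
rotate-attacks-self : ∀ t {p} → t < 3 → Attacks (rotate (suc t) p) p → Attacks p (queen 0)
rotate-attacks-self 0 {p} t<3 a = turn-attacks-self {p} a
rotate-attacks-self 1 {p} t<3 a = turn²-attacks-self {p} a
-- Three quarter turns are undone by one more: p then attacks turn p.
rotate-attacks-self 2 {p} t<3 a = turn-attacks-self {p}
  (Attacks-sym {p} (subst (λ p′ → Attacks p′ (turn p)) (turn⁴ p)
                          (Attacks-turn {rotate 3 p} {p} a)))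
rotate-attacks-self (suc (suc (suc t))) (s≤s (s≤s (s≤s ()))) a

rotate-+ : ∀ s t {p} → rotate (t + s) p ≡ rotate t (rotate s p)
rotate-+ s zero    = refl
rotate-+ s (suc t) = cong turn (rotate-+ s t)

origin∈queens : ∀ n → queen 0 ∈ queens n
origin∈queens zero    = here refl
origin∈queens (suc n) = there (there (there (there (origin∈queens n))))

∈⇒Any-Attacks : ∀ {p q L} → q ∈ L → Attacks p q → Any (Attacks p) L
∈⇒Any-Attacks (here refl) a = here a
∈⇒Any-Attacks (there i)   a = there (∈⇒Any-Attacks i a)

rotation-unattacked : ∀ n r → r < 4 →
  Unattacking (rotations r (queen (suc n)) (queens n)) (rotate r (queen (suc n)))
rotation-unattacked n r r<4 = ¬Any⇒All¬ _ (go r 0 refl)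
  where
  q : Point
  q = queen (suc n)

  rotate-q-unattacked : ∀ s → ¬ Any (Attacks (rotate s q)) (queens n)
  rotate-q-unattacked s a =
    queen-not-Covered (suc n) (Covered-rotate⁻ s {q} (attacked⇒Covered n {rotate s q} a))

  -- In the step, turn r of q is compared with turn s, and is t + 1 turns ahead of it.
  go : ∀ s t → t + s ≡ r → ¬ Any (Attacks (rotate r q)) (rotations s q (queens n))
  go zero    t eq a         = rotate-q-unattacked r a
  go (suc s) t eq (there a) = go s (suc t) (trans (sym (+-suc t s)) eq) a
  go (suc s) t eq (here a)  =
    rotate-q-unattacked s (∈⇒Any-Attacks (origin∈queens n)
      (rotate-attacks-self t {rotate s q} t<3
        (subst (λ p → Attacks p (rotate s q))
          (trans (cong (λ r → rotate r q) (trans (sym eq) (+-suc t s))) (rotate-+ s (suc t)))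
          a)))
    where
    t<3 : t < 3
    t<3 = ≤-pred (≤-<-trans (subst (suc t ≤_) (trans (sym (+-suc t s)) eq) (m≤m+n (suc t) s)) r<4)

-- Each edge of a shell is a turn of the first

inShell-edge₁ : ∀ k j → j < 2 * suc k → inShell (suc k) j ≡ edge₁ (suc k) j
inShell-edge₁ k j lt rewrite dec-true (j <? 2 * suc k) lt = refl

inShell-edge₂ : ∀ k j → 2 * suc k ≤ j → j < 4 * suc k →
                inShell (suc k) j ≡ edge₂ (suc k) (j ∸ 2 * suc k)
inShell-edge₂ k j ge lt
  rewrite dec-false (j <? 2 * suc k) (≤⇒≯ ge)
        | dec-true (j <? 4 * suc k) lt = refl

inShell-edge₃ : ∀ k j → 4 * suc k ≤ j → j < 6 * suc k →
                inShell (suc k) j ≡ edge₃ (suc k) (j ∸ 4 * suc k)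
inShell-edge₃ k j ge lt
  rewrite dec-false (j <? 2 * suc k) (≤⇒≯ (≤-trans (*-monoˡ-≤ (suc k) {2} {4} (s≤s (s≤s z≤n))) ge))
        | dec-false (j <? 4 * suc k) (≤⇒≯ ge)
        | dec-true (j <? 6 * suc k) lt = refl

inShell-edge₄ : ∀ k j → 6 * suc k ≤ j →
                inShell (suc k) j ≡ edge₄ (suc k) (j ∸ 6 * suc k)
inShell-edge₄ k j ge
  rewrite dec-false (j <? 2 * suc k) (≤⇒≯ (≤-trans (*-monoˡ-≤ (suc k) {2} {6} (s≤s (s≤s z≤n))) ge))
        | dec-false (j <? 4 * suc k) (≤⇒≯ (≤-trans (*-monoˡ-≤ (suc k) {4} {6} (s≤s (s≤s (s≤s (s≤s z≤n))))) ge))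
        | dec-false (j <? 6 * suc k) (≤⇒≯ ge) = refl

edge₃-turn : ∀ k i → edge₃ k i ≡ turn (edge₂ k i)
edge₃-turn k i = cong (_, - (+ k)) (lemma (+ k) (+ i))
  where
  lemma : ∀ k i → - k ℤ.+ + 1 ℤ.+ i ≡ - (k ℤ.- + 1 ℤ.- i)
  lemma = ℤSolver.solve-∀

edge₄-turn : ∀ k i → edge₄ k i ≡ turn (edge₃ k i)
edge₄-turn k i = cong (_, - (+ k) ℤ.+ + 1 ℤ.+ + i) (sym (ℤₚ.neg-involutive (+ k)))

inShell-rotate : ∀ k r i → r < 4 → i < 2 * suc k →
                 inShell (suc k) (r * (2 * suc k) + i) ≡ rotate r (edge₁ (suc k) i)
inShell-rotate k 0 i r<4 i<2K = inShell-edge₁ k i i<2K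
inShell-rotate k 1 i r<4 i<2K =
  trans (cong (λ l → inShell (suc k) (l + i)) (*-identityˡ (2 * suc k)))
    (trans (inShell-edge₂ k (2 * suc k + i) (m≤m+n (2 * suc k) i)
             (subst (2 * suc k + i <_) (lemma (suc k)) (+-monoʳ-< (2 * suc k) i<2K)))
      (cong (edge₂ (suc k)) (m+n∸m≡n (2 * suc k) i)))
  where
  lemma : ∀ k → 2 * k + 2 * k ≡ 4 * k
  lemma = solve-∀
inShell-rotate k 2 i r<4 i<2K =
  trans (cong (λ l → inShell (suc k) (l + i)) (lemma₁ (suc k)))
    (trans (inShell-edge₃ k (4 * suc k + i) (m≤m+n (4 * suc k) i)
             (subst (4 * suc k + i <_) (lemma₂ (suc k)) (+-monoʳ-< (4 * suc k) i<2K)))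
      (trans (cong (edge₃ (suc k)) (m+n∸m≡n (4 * suc k) i)) (edge₃-turn (suc k) i)))
  where
  lemma₁ : ∀ k → 2 * (2 * k) ≡ 4 * k
  lemma₁ = solve-∀
  lemma₂ : ∀ k → 4 * k + 2 * k ≡ 6 * k
  lemma₂ = solve-∀
inShell-rotate k 3 i r<4 i<2K =
  trans (cong (λ l → inShell (suc k) (l + i)) (lemma (suc k)))
    (trans (inShell-edge₄ k (6 * suc k + i) (m≤m+n (6 * suc k) i))
      (trans (cong (edge₄ (suc k)) (m+n∸m≡n (6 * suc k) i))
        (trans (edge₄-turn (suc k) i) (cong turn (edge₃-turn (suc k) i)))))
  where
  lemma : ∀ k → 3 * (2 * k) ≡ 6 * k
  lemma = solve-∀
inShell-rotate k (suc (suc (suc (suc r)))) i (s≤s (s≤s (s≤s (s≤s ())))) i<2K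

-- The number of the first cell on edge r + 1 of shell k + 1.
edgeStart : ℕ → ℕ → ℕ
edgeStart k r = (2 * k + 1) ^ 2 + r * (2 * suc k)

edgeStart-zero : ∀ k → edgeStart k 0 ≡ (2 * k + 1) ^ 2
edgeStart-zero k = +-identityʳ ((2 * k + 1) ^ 2)

edgeStart-suc : ∀ k r → edgeStart k (suc r) ≡ edgeStart k r + 2 * suc k
edgeStart-suc k r =
  trans (cong (λ l → (2 * k + 1) ^ 2 + l) (+-comm (2 * suc k) (r * (2 * suc k))))
        (sym (+-assoc ((2 * k + 1) ^ 2) (r * (2 * suc k)) (2 * suc k)))

edgeStart-four : ∀ k → edgeStart k 4 ≡ (2 * suc k + 1) ^ 2
edgeStart-four = lemma
  where
  -- The squares are unfolded for the benefit of the ring solver.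
  lemma : ∀ k → (2 * k + 1) * ((2 * k + 1) * 1) + 4 * (2 * (1 + k))
              ≡ (2 * (1 + k) + 1) * ((2 * (1 + k) + 1) * 1)
  lemma = solve-∀

cell-edge : ∀ k r i → r < 4 → i < 2 * suc k →
            cell (edgeStart k r + i) ≡ rotate r (edge₁ (suc k) i)
cell-edge k r i r<4 i<2K =
  trans (cong cell (+-assoc ((2 * k + 1) ^ 2) (r * (2 * suc k)) i))
    (trans (cell-numbering k (r * (2 * suc k) + i) bound) (inShell-rotate k r i r<4 i<2K))
  where
  bound : r * (2 * suc k) + i < 8 * suc k
  bound = <-≤-trans (+-monoʳ-< (r * (2 * suc k)) i<2K)
    (≤-trans (≤-reflexive (+-comm (r * (2 * suc k)) (2 * suc k)))
      (≤-trans (*-monoˡ-≤ (2 * suc k) r<4) (≤-reflexive (lemma (suc k)))))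
    where
    lemma : ∀ k → 4 * (2 * k) ≡ 8 * k
    lemma = solve-∀

-- Runs of cells

skip-one : ∀ c {L} → queensBefore c ≡ L → ¬ Unattacking L (cell c) → queensBefore (suc c) ≡ L
skip-one c refl ¬u rewrite dec-false (unattacking? (queensBefore c) (cell c)) ¬u = refl

skip : ∀ c len {L} → queensBefore c ≡ L →
       (∀ j → j < len → ¬ Unattacking L (cell (c + j))) → queensBefore (c + len) ≡ L
skip c zero    eq ¬u = trans (cong queensBefore (+-identityʳ c)) eq
skip c (suc l) eq ¬u =
  trans (cong queensBefore (+-suc c l))
    (skip-one (c + l) (skip c l eq (λ j lt → ¬u j (m<n⇒m<1+n lt))) (¬u l ≤-refl))

place : ∀ c {L} → queensBefore c ≡ L → Unattacking L (cell c) →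
        HasQueen c × queensBefore (suc c) ≡ cell c ∷ L
place c refl u = u , queensBefore-placed c u

-- Shells without queens

edge₁-diff : ∀ k j → ∣ (+ k ℤ.- + 1 ℤ.- + j) ℤ.- + k ∣ ≡ suc j
edge₁-diff k j = cong ∣_∣ (lemma (+ k) (+ j))
  where
  lemma : ∀ k j → (k ℤ.- + 1 ℤ.- j) ℤ.- k ≡ - (+ 1 ℤ.+ j)
  lemma = ℤSolver.solve-∀

-- The cell (x , K) with K = k + 1 and x = K - 1 - j satisfies |x| + |x - K| = K when
-- x is nonnegative, and |x| + |x + K| = K when x is negative.
edge₁-bound : ∀ {a d} k j → j < 2 * suc k →
  a ≤ ∣ + suc k ℤ.- + 1 ℤ.- + j ∣ →
  d ≤ ∣ (+ suc k ℤ.- + 1 ℤ.- + j) ℤ.+ + suc k ∣ →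
  d ≤ suc j → a + d ≤ suc k
edge₁-bound {a} {d} k j j<2K a≤∣x∣ d≤∣x+y∣ d≤1+j with j ≤? k
... | yes j≤k with e , refl ← m≤n⇒∃[o]m+o≡n j≤k =
  subst (a + d ≤_) (trans (+-suc e j) (cong suc (+-comm e j)))
    (+-mono-≤ (subst (a ≤_) (cong ∣_∣ (lemma (+ j) (+ e))) a≤∣x∣) d≤1+j)
  where
  lemma : ∀ j e → (+ 1 ℤ.+ (j ℤ.+ e)) ℤ.- + 1 ℤ.- j ≡ e
  lemma = ℤSolver.solve-∀
... | no j≰k with e , refl ← m≤n⇒∃[o]m+o≡n (≰⇒> j≰k)
  with f , refl ← m≤n⇒∃[o]m+o≡n
    (≤-pred (subst (e <_) (+-identityʳ (suc k)) (+-cancelˡ-< (suc k) e (suc k + 0) j<2K))) =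
  +-mono-≤ (subst (a ≤_) (cong ∣_∣ (lemma₁ (+ suc (e + f)) (+ e))) a≤∣x∣)
           (subst (d ≤_) (cong ∣_∣ (lemma₂ (+ e) (+ f))) d≤∣x+y∣)
  where
  lemma₁ : ∀ K e → K ℤ.- + 1 ℤ.- (K ℤ.+ e) ≡ - (+ 1 ℤ.+ e)
  lemma₁ = ℤSolver.solve-∀
  lemma₂ : ∀ e f → let K = + 1 ℤ.+ (e ℤ.+ f) in (K ℤ.- + 1 ℤ.- (K ℤ.+ e)) ℤ.+ K ≡ f
  lemma₂ = ℤSolver.solve-∀

-- A cell of edge 1 that is not attacked by the queens before queen n and their
-- turns can only occur from shell Y n onwards.
not-Covered⇒Y≤ : ∀ n k j → j < 2 * suc k →
  ¬ Covered (XYs n) (MPs n) (edge₁ (suc k) j) → Y n ≤ suc k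
not-Covered⇒Y≤ n k j j<2K ¬c = subst (_≤ suc k) (sym (Y≡X+M n))
  (edge₁-bound k j j<2K
    (X≤ n (¬c ∘ inj₁))
    (M≤ n (¬c ∘ inj₂ ∘ inj₂ ∘ inj₁))
    (subst (M n ≤_) (edge₁-diff (suc k) j) (M≤ n (¬c ∘ inj₂ ∘ inj₂ ∘ inj₂))))

Covered⇒¬Unattacking : ∀ n r {p} → Covered (XYs (suc n)) (MPs (suc n)) p →
                       ¬ Unattacking (queens n) (rotate r p)
Covered⇒¬Unattacking n r {p} c u =
  All¬⇒¬Any u (Covered⇒attacked n {rotate r p} (Covered-rotate r {p} c))

empty-shell : ∀ n k → suc k < Y (suc n) → queensBefore ((2 * k + 1) ^ 2) ≡ queens n →
              queensBefore ((2 * suc k + 1) ^ 2) ≡ queens n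
empty-shell n k K<Y eq = trans (cong queensBefore (sym (edgeStart-four k))) (edges 4 ≤-refl)
  where
  edges : ∀ r → r ≤ 4 → queensBefore (edgeStart k r) ≡ queens n
  edges zero    r≤4 = trans (cong queensBefore (edgeStart-zero k)) eq
  edges (suc r) r<4 =
    trans (cong queensBefore (edgeStart-suc k r))
      (skip (edgeStart k r) (2 * suc k) (edges r (<⇒≤ r<4)) λ j j<2K u →
        <⇒≱ K<Y (not-Covered⇒Y≤ (suc n) k j j<2K λ c →
          Covered⇒¬Unattacking n r {edge₁ (suc k) j} c
            (subst (Unattacking (queens n)) (cell-edge k r j r<4 j<2K) u)))

-- Shells with four queens

Unattacking-rotations⁻ : ∀ r {q L p} → Unattacking (rotations r q L) p → Unattacking L p
Unattacking-rotations⁻ zero    u       = u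
Unattacking-rotations⁻ (suc r) (_ ∷ u) = Unattacking-rotations⁻ r u

length-rotations : ∀ r {q L} → length (rotations r q L) ≡ r + length L
length-rotations zero    = refl
length-rotations (suc r) = cong suc (length-rotations r)

length-queens : ∀ n → length (queens n) ≡ 4 * n + 1
length-queens zero    = refl
length-queens (suc n) = trans (cong (λ l → 4 + l) (length-queens n)) (lemma n)
  where
  lemma : ∀ n → 4 + (4 * n + 1) ≡ 4 * (1 + n) + 1
  lemma = solve-∀

-- Shell K = k + 1 = Y (n + 1), entered with queens 0 to n and all their turns in place.
-- Each edge receives its queen at offset i = M (n + 1) - 1.
module OccupiedShell (n k i : ℕ) (Y≡K : Y (suc n) ≡ suc k) (M≡ : M (suc n) ≡ suc i)
                     (start : queensBefore ((2 * k + 1) ^ 2) ≡ queens n) where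

  q : Point
  q = queen (suc n)

  -- The queens in place when edge r + 1 is entered.
  L : ℕ → List Point
  L r = rotations r q (queens n)

  K≡X+1+i : suc k ≡ X (suc n) + suc i
  K≡X+1+i = trans (sym Y≡K) (cong (λ m → X (suc n) + m) M≡)

  edge₁-queen : edge₁ (suc k) i ≡ q
  edge₁-queen = cong₂ _,_
    (trans (cong (λ K → + K ℤ.- + 1 ℤ.- + i) K≡X+1+i) (lemma (+ X (suc n)) (+ i)))
    (cong +_ (sym Y≡K))
    where
    lemma : ∀ a i → (a ℤ.+ (+ 1 ℤ.+ i)) ℤ.- + 1 ℤ.- i ≡ a
    lemma = ℤSolver.solve-∀

  -- The offset of the new queen lies on the edge, as M (n + 1) is at most K.
  i<2K : i < 2 * suc k
  i<2K = ≤-trans (subst (suc i ≤_) (sym K≡X+1+i) (m≤n+m (suc i) (X (suc n))))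
                 (m≤m+n (suc k) (suc k + 0))

  before : ∀ r j → r < 4 → j < i → ¬ Unattacking (L r) (cell (edgeStart k r + j))
  before r j r<4 j<i u =
    Covered⇒¬Unattacking n r {edge₁ (suc k) j}
      (inj₂ (inj₂ (inj₂ (subst (_∈ MPs (suc n)) (sym (edge₁-diff (suc k) j))
        (<mex⇒∈ (MPs (suc n)) (subst (suc j <_) (sym M≡) (s≤s j<i)))))))
      (Unattacking-rotations⁻ r
        (subst (Unattacking (L r)) (cell-edge k r j r<4 (<-trans j<i i<2K)) u))

  place-on-edge : ∀ r → r < 4 → queensBefore (edgeStart k r) ≡ L r →
    IsNthQueen (length (L r)) (rotate r q) × queensBefore (edgeStart k (suc r)) ≡ L (suc r)
  place-on-edge r r<4 eq =
    (c + i , hasQueen , cong length reached , cell≡) ,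
    trans (cong queensBefore next)
      (skip (suc (c + i)) rest (trans placed (cong (_∷ L r) cell≡)) after)
    where
    c rest : ℕ
    c = edgeStart k r
    rest = 2 * suc k ∸ suc i

    reached : queensBefore (c + i) ≡ L r
    reached = skip c i eq (λ j j<i → before r j r<4 j<i)

    cell≡ : cell (c + i) ≡ rotate r q
    cell≡ = trans (cell-edge k r i r<4 i<2K) (cong (rotate r) edge₁-queen)

    placement : HasQueen (c + i) × queensBefore (suc (c + i)) ≡ cell (c + i) ∷ L r
    placement = place (c + i) reached
      (subst (Unattacking (L r)) (sym cell≡) (rotation-unattacked n r r<4))

    hasQueen : HasQueen (c + i)
    hasQueen = proj₁ placement

    placed : queensBefore (suc (c + i)) ≡ cell (c + i) ∷ L r
    placed = proj₂ placement

    next : edgeStart k (suc r) ≡ suc (c + i) + rest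
    next = trans (edgeStart-suc k r)
      (trans (cong (λ l → c + l) (sym (m+[n∸m]≡n i<2K)))
        (trans (sym (+-assoc c (suc i) rest)) (cong (_+ rest) (+-suc c i))))

    -- Cells of the same edge share a row or a column.
    after : ∀ j → j < rest → ¬ Unattacking (L (suc r)) (cell (suc (c + i) + j))
    after j j<rest (¬a ∷ _) = ¬a (subst (λ p → Attacks p (rotate r q)) (sym cell-j≡)
      (Attacks-rotate r {edge₁ (suc k) (suc i + j)} {q} (inj₂ (inj₁ (cong +_ (sym Y≡K))))))
      where
      cell-j≡ : cell (suc (c + i) + j) ≡ rotate r (edge₁ (suc k) (suc i + j))
      cell-j≡ = trans (cong cell (trans (cong (_+ j) (sym (+-suc c i))) (+-assoc c (suc i) j)))
        (cell-edge k r (suc i + j) r<4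
          (subst (suc i + j <_) (m+[n∸m]≡n i<2K) (+-monoʳ-< (suc i) j<rest)))

  edges : ∀ r → r ≤ 4 → queensBefore (edgeStart k r) ≡ L r
  edges zero    r≤4 = trans (cong queensBefore (edgeStart-zero k)) start
  edges (suc r) r<4 = proj₂ (place-on-edge r r<4 (edges r (<⇒≤ r<4)))

  nthQueen : ∀ r → r < 4 → IsNthQueen (4 * n + suc r) (rotate r q)
  nthQueen r r<4 = subst (λ m → IsNthQueen m (rotate r q)) length≡
    (proj₁ (place-on-edge r r<4 (edges r (<⇒≤ r<4))))
    where
    lemma : ∀ r n → r + (4 * n + 1) ≡ 4 * n + (1 + r)
    lemma = solve-∀
    length≡ : length (L r) ≡ 4 * n + suc r
    length≡ = trans (length-rotations r)
      (trans (cong (λ l → r + l) (length-queens n)) (lemma r n))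

  shell-filled : queensBefore ((2 * suc k + 1) ^ 2) ≡ queens (suc n)
  shell-filled = trans (cong queensBefore (sym (edgeStart-four k))) (edges 4 ≤-refl)

-- Induction over the shells

pred-of-> : ∀ {m n} → m < n → ∃[ o ] (m ≤ o × n ≡ suc o)
pred-of-> (s≤s m≤o) = _ , m≤o , refl

-- After shells 0 to k, the queens placed are the turns of queens 0 to n.
FilledTo : ℕ → ℕ → Set
FilledTo n k = queensBefore ((2 * k + 1) ^ 2) ≡ queens n

empty-shells : ∀ n {k} → FilledTo n (Y n) → Y n ≤′ k → k < Y (suc n) → FilledTo n k
empty-shells n filled ≤′-refl      k<Y = filled
empty-shells n filled (≤′-step {k} le) K<Y =
  empty-shell n k K<Y (empty-shells n filled le (<-trans (n<1+n k) K<Y))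

-- The hypotheses of OccupiedShell hold on entering shell Y (n + 1).
on-entering : ∀ n → FilledTo n (Y n) →
  ∃[ k ] ∃[ i ] (Y (suc n) ≡ suc k × M (suc n) ≡ suc i × FilledTo n k)
on-entering n filled =
  let k , Y≤k , Y≡ = pred-of-> (Y-increasing n)
      i , _   , M≡ = pred-of-> (M-increasing n)
  in k , i , Y≡ , M≡ ,
     empty-shells n filled (≤⇒≤′ Y≤k) (subst (k <_) (sym Y≡) ≤-refl)

filled-to-Y : ∀ n → FilledTo n (Y n)
filled-to-Y zero    = refl
filled-to-Y (suc n) =
  let k , i , Y≡ , M≡ , filled = on-entering n (filled-to-Y n)
  in subst (FilledTo (suc n)) (sym Y≡) (OccupiedShell.shell-filled n k i Y≡ M≡ filled)

queen-rotations : ∀ n r → r < 4 → IsNthQueen (4 * n + suc r) (rotate r (queen (suc n)))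
queen-rotations n =
  let k , i , Y≡ , M≡ , filled = on-entering n (filled-to-Y n)
  in OccupiedShell.nthQueen n k i Y≡ M≡ filled

theorem1 : (IsNthQueen 0 (+ X 0 , + Y 0) × _≡_ {A = Point} (+ X 0 , + Y 0) (+ 0 , + 0)) ×
    (∀ (k : ℕ) →
    IsNthQueen (4 * k + 1) (+ X (k + 1) , + Y (k + 1)) ×
    IsNthQueen (4 * k + 2) (- (+ Y (k + 1)) , + X (k + 1)) ×
    IsNthQueen (4 * k + 3) (- (+ X (k + 1)) , - (+ Y (k + 1))) ×
    IsNthQueen (4 * k + 4) (+ Y (k + 1) , - (+ X (k + 1))))
theorem1 = ((0 , [] , refl , refl) , refl) , λ k →
  let at : ∀ r → r < 4 → IsNthQueen (4 * k + suc r) (rotate r (queen (k + 1)))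
      at r r<4 = subst (λ m → IsNthQueen (4 * k + suc r) (rotate r (queen m)))
                       (+-comm 1 k) (queen-rotations k r r<4)
  in at 0 (s≤s z≤n) ,
     at 1 (s≤s (s≤s z≤n)) ,
     at 2 (s≤s (s≤s (s≤s z≤n))) ,
     subst (λ y → IsNthQueen (4 * k + 4) (y , - (+ X (k + 1))))
           (ℤₚ.neg-involutive (+ Y (k + 1)))
           (at 3 (s≤s (s≤s (s≤s (s≤s z≤n)))))
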